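{- For all integers $m\geq 1$, $r\geq 1$ and $q\geq 2$, $$S_{r^m,q}=\sum_{\xi\in\mathcal{C}_m}\binom{m}{\xi_1,\xi_2,\ldots,\xi_p}\big\{\zeta(q,r\xi_1,r\xi_2,\ldots,r\xi_p)+\zeta(q+r\xi_1,r\xi_2,\ldots,r\xi_p)\big\},$$ where $\xi=(\xi_1,\xi_2,\ldots,\xi_p)$ and $p$ is the number of parts of $\xi$.
   Context: Generalized harmonic numbers: $H_n^{(r)}=\sum_{k=1}^n k^{ -r}$ for positive integers $n,r$. Euler sum: $S_{r^m,q}=\sum_{n=1}^{\infty}\frac{(H_n^{(r)})^m}{n^q}$. Multiple zeta values: for positive integers $s_1,\ldots,s_k$ with $s_1>1$, $\zeta(s_1,s_2,\ldots,s_k)=\sum_{n_1>n_2>\cdots>n_k\geq 1}\frac{1}{n_1^{s_1}n_2^{s_2}\cdots n_k^{s_k}}$. A composition of $m$ is an ordered tuple of positive integers whose elements sum to $m$; $\mathcal{C}_m$ is the set of all compositions of $m$. Multinomial coefficients: $\binom{m}{\xi_1,\xi_2,\ldots,\xi_p}=\frac{m!}{\xi_1!\,\xi_2!\cdots\xi_p!}$. -}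

module Defs where

import Algebra.Definitions.RawSemiring
open import Data.Integer.Base as ℤ using (+_; +[1+_])
import Data.Integer.Properties as ℤ
open import Data.List.Base as List using (List; []; _∷_; foldr; _++_)
open import Data.List.Membership.Propositional using (_∈_)
open import Data.List.Membership.Propositional.Properties
  using (∈-++⁺ˡ; ∈-++⁺ʳ; ∈-++⁻; ∈-map⁺; ∈-map⁻)
open import Data.List.NonEmpty using (List⁺; _∷_; _∷⁺_; [_]; toList; head)
open import Data.List.Relation.Unary.All using (All; []; _∷_)
open import Data.List.Relation.Unary.Any using (here)
open import Data.List.Relation.Unary.Unique.Propositional using (Unique)
import Data.List.Relation.Unary.Unique.Propositional.Properties as Unique
open import Data.List.Relation.Unary.AllPairs using ([]; _∷_)
open import Data.Nat.Base as ℕ using (ℕ; zero; suc; pred; NonZero; z≤n; s≤s; _!)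
open import Data.Nat.Coprimality using (1-coprimeTo)
import Data.Nat.Coprimality as Coprime
open import Data.Nat.ListAction using (sum; product)
open import Data.Nat.ListAction.Properties using (product≢0)
import Data.Nat.Properties as ℕ
open import Data.Product.Base using (∃; _×_; _,_; proj₁; proj₂)
open import Data.Rational.Base
  using (ℚ; mkℚ; 0ℚ; 1ℚ; ½; _+_; _*_; _-_; -_; _/_; 1/_; _≤_; _<_; *≤*; *<*; ∣_∣;
         positive; nonNegative; +-*-rawSemiring; Positive)
open import Data.Rational.Properties
open import Data.Rational.Solver using (module +-*-Solver)
open import Data.Sum.Base using (inj₁; inj₂; [_,_]′)
open import Function.Base using (_∘_; case_of_)
open import Function.Bundles using (_⇔_; mk⇔)
open import Relation.Binary.PropositionalEquality
  using (_≡_; refl; sym; trans; cong; cong₂; subst; subst₂; module ≡-Reasoning)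
open import Relation.Binary.Structures using (IsEquivalence)
open import Relation.Nullary using (contradiction)
open +-*-Solver using (solve; _:+_; _:*_; :-_; _:-_; _:=_; con)
open Algebra.Definitions.RawSemiring +-*-rawSemiring public using (_^_)

record ℕ⁺ : Set where
  constructor ⟨_⟩
  field
    value       : ℕ
    .{{value≢0}} : NonZero value

open ℕ⁺ public using (value)

m+n≢0 : ∀ m n .{{_ : NonZero m}} → NonZero (m ℕ.+ n)
m+n≢0 (suc m) n = _

infixl 7 _*⁺_
infixl 6 _+⁺_

_+⁺_ : ℕ⁺ → ℕ⁺ → ℕ⁺
⟨ m ⟩ +⁺ ⟨ n ⟩ = record { value = m ℕ.+ n ; value≢0 = m+n≢0 m n }

_*⁺_ : ℕ⁺ → ℕ⁺ → ℕ⁺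
⟨ m ⟩ *⁺ ⟨ n ⟩ = record { value = m ℕ.* n ; value≢0 = ℕ.m*n≢0 m n }

-- Real numbers are Cauchy sequences of rationals, compared by _≈_.

Cauchy : (ℕ → ℚ) → Set
Cauchy x = ∀ ε → 0ℚ < ε → ∃ λ N → ∀ m n → N ℕ.≤ m → N ℕ.≤ n → ∣ x m - x n ∣ < ε

Null : (ℕ → ℚ) → Set
Null x = ∀ ε → 0ℚ < ε → ∃ λ N → ∀ n → N ℕ.≤ n → ∣ x n ∣ < ε

record ℝ : Set where
  constructor lim
  field
    seq    : ℕ → ℚ
    cauchy : Cauchy seq

open ℝ public

infix 4 _≈_

_≈_ : ℝ → ℝ → Set
x ≈ y = Null (λ n → seq x n - seq y n)

half-pos : ∀ {ε} → 0ℚ < ε → 0ℚ < ½ * ε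
half-pos {ε} 0<ε = positive⁻¹ (½ * ε) {{pos*pos⇒pos ½ ε {{positive 0<ε}}}}

halves : ∀ ε → ½ * ε + ½ * ε ≡ ε
halves ε = trans (sym (*-distribʳ-+ ε ½ ½)) (*-identityˡ ε)

0≤-* : ∀ {p q} → 0ℚ ≤ p → 0ℚ ≤ q → 0ℚ ≤ p * q
0≤-* {p} {q} 0≤p 0≤q =
  nonNegative⁻¹ (p * q) {{nonNeg*nonNeg⇒nonNeg p {{nonNegative 0≤p}} q {{nonNegative 0≤q}}}}

0≤-+ : ∀ {p q} → 0ℚ ≤ p → 0ℚ ≤ q → 0ℚ ≤ p + q
0≤-+ = +-mono-≤

*-mono₀-≤ : ∀ {p q r s} → 0ℚ ≤ p → p ≤ q → 0ℚ ≤ r → r ≤ s → p * r ≤ q * s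
*-mono₀-≤ {p} {q} {r} {s} 0≤p p≤q 0≤r r≤s = ≤-trans
  (*-monoʳ-≤-nonNeg r {{nonNegative 0≤r}} p≤q)
  (*-monoˡ-≤-nonNeg q {{nonNegative (≤-trans 0≤p p≤q)}} r≤s)

Null-+ : ∀ x y → Null x → Null y → Null (λ n → x n + y n)
Null-+ x y nx ny ε 0<ε with nx (½ * ε) (half-pos 0<ε) | ny (½ * ε) (half-pos 0<ε)
... | M , xM | N , yN = M ℕ.+ N , λ n M+N≤n → begin-strict
  ∣ x n + y n ∣      ≤⟨ ∣p+q∣≤∣p∣+∣q∣ (x n) (y n) ⟩
  ∣ x n ∣ + ∣ y n ∣  <⟨ +-mono-< (xM n (ℕ.m+n≤o⇒m≤o M M+N≤n)) (yN n (ℕ.m+n≤o⇒n≤o M M+N≤n)) ⟩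
  ½ * ε + ½ * ε      ≡⟨ halves ε ⟩
  ε                  ∎
  where open ≤-Reasoning

Cauchy-+ : ∀ x y → Cauchy x → Cauchy y → Cauchy (λ n → x n + y n)
Cauchy-+ x y cx cy ε 0<ε with cx (½ * ε) (half-pos 0<ε) | cy (½ * ε) (half-pos 0<ε)
... | M , xM | N , yN = M ℕ.+ N , λ m n ≤m ≤n → begin-strict
  ∣ (x m + y m) - (x n + y n) ∣      ≡⟨ cong ∣_∣ (rearrange (x m) (y m) (x n) (y n)) ⟩
  ∣ (x m - x n) + (y m - y n) ∣      ≤⟨ ∣p+q∣≤∣p∣+∣q∣ (x m - x n) (y m - y n) ⟩
  ∣ x m - x n ∣ + ∣ y m - y n ∣      <⟨ +-mono-<
                                          (xM m n (ℕ.m+n≤o⇒m≤o M ≤m) (ℕ.m+n≤o⇒m≤o M ≤n))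
                                          (yN m n (ℕ.m+n≤o⇒n≤o M ≤m) (ℕ.m+n≤o⇒n≤o M ≤n)) ⟩
  ½ * ε + ½ * ε                      ≡⟨ halves ε ⟩
  ε                                  ∎
  where
  open ≤-Reasoning
  rearrange : ∀ a b c d → (a + b) - (c + d) ≡ (a - c) + (b - d)
  rearrange = solve 4 (λ a b c d → (a :+ b) :- (c :+ d) := (a :- c) :+ (b :- d)) refl

scaled-by : ∀ c d → ∣ c ∣ ≤ d → Positive d →
            ∀ {ε} → 0ℚ < ε → ∃ λ δ → 0ℚ < δ × (∀ p → ∣ p ∣ < δ → ∣ c * p ∣ < ε)
scaled-by c d ∣c∣≤d d>0 {ε} 0<ε = ε * 1/d , 0<δ , λ p ∣p∣<δ → begin-strict
  ∣ c * p ∣        ≡⟨ ∣p*q∣≡∣p∣*∣q∣ c p ⟩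
  ∣ c ∣ * ∣ p ∣    ≤⟨ *-monoʳ-≤-nonNeg ∣ p ∣ {{∣-∣-nonNeg p}} ∣c∣≤d ⟩
  d * ∣ p ∣        <⟨ *-monoʳ-<-pos d {{d>0}} ∣p∣<δ ⟩
  d * (ε * 1/d)    ≡⟨ trans (cong (d *_) (*-comm ε 1/d)) (sym (*-assoc d 1/d ε)) ⟩
  d * 1/d * ε      ≡⟨ trans (cong (_* ε) (*-inverseʳ d {{pos⇒nonZero d {{d>0}}}})) (*-identityˡ ε) ⟩
  ε                ∎
  where
  open ≤-Reasoning
  1/d : ℚ
  1/d = (1/ d) {{pos⇒nonZero d {{d>0}}}}
  0<δ : 0ℚ < ε * 1/d
  0<δ = positive⁻¹ (ε * 1/d) {{pos*pos⇒pos ε {{positive 0<ε}} 1/d {{1/pos⇒pos d {{d>0}}}}}}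

scaled : ∀ c {ε} → 0ℚ < ε → ∃ λ δ → 0ℚ < δ × (∀ p → ∣ p ∣ < δ → ∣ c * p ∣ < ε)
scaled c = scaled-by c (∣ c ∣ + 1ℚ)
  (subst (_≤ ∣ c ∣ + 1ℚ) (+-identityʳ ∣ c ∣) (+-monoʳ-≤ ∣ c ∣ (nonNegative⁻¹ 1ℚ)))
  (nonNeg+pos⇒pos ∣ c ∣ {{∣-∣-nonNeg c}} 1ℚ)

Null-* : ∀ c x → Null x → Null (λ n → c * x n)
Null-* c x nx ε 0<ε =
  let δ , 0<δ , c< = scaled c 0<ε
      N , xN       = nx δ 0<δ
  in N , λ n N≤n → c< (x n) (xN n N≤n)

Cauchy-* : ∀ c x → Cauchy x → Cauchy (λ n → c * x n)
Cauchy-* c x cx ε 0<ε =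
  let δ , 0<δ , c< = scaled c 0<ε
      N , xN       = cx δ 0<δ
  in N , λ m n N≤m N≤n →
    subst (λ p → ∣ p ∣ < ε) (distrib c (x m) (x n)) (c< (x m - x n) (xN m n N≤m N≤n))
  where
  distrib : ∀ c a b → c * (a - b) ≡ c * a - c * b
  distrib = solve 3 (λ c a b → c :* (a :- b) := c :* a :- c :* b) refl

Cauchy-const : ∀ c → Cauchy (λ _ → c)
Cauchy-const c ε 0<ε = 0 , λ _ _ _ _ → subst (λ p → ∣ p ∣ < ε) (sym (+-inverseʳ c)) 0<ε

≈-isEquivalence : IsEquivalence _≈_
≈-isEquivalence = record
  { refl  = λ {x} ε 0<ε → 0 , λ n _ → subst (λ p → ∣ p ∣ < ε) (sym (+-inverseʳ (seq x n))) 0<ε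
  ; sym   = λ {x} {y} x≈y ε 0<ε → proj₁ (x≈y ε 0<ε) , λ n N≤n →
      subst (_< ε)
        (trans (sym (∣-p∣≡∣p∣ (seq x n - seq y n))) (cong ∣_∣ (flip (seq x n) (seq y n))))
        (proj₂ (x≈y ε 0<ε) n N≤n)
  ; trans = λ {x} {y} {z} x≈y y≈z ε 0<ε →
      let N , xzN = Null-+ (λ n → seq x n - seq y n) (λ n → seq y n - seq z n) x≈y y≈z ε 0<ε in
      N , λ n N≤n → subst (λ p → ∣ p ∣ < ε) (chain (seq x n) (seq y n) (seq z n)) (xzN n N≤n)
  }
  where
  flip : ∀ a b → - (a - b) ≡ b - a
  flip = solve 2 (λ a b → :- (a :- b) := b :- a) refl
  chain : ∀ a b c → (a - b) + (b - c) ≡ a - c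
  chain = solve 3 (λ a b c → (a :- b) :+ (b :- c) := a :- c) refl

infixl 6 _+ᴿ_
infixl 7 _·_

0ᴿ : ℝ
0ᴿ = lim (λ _ → 0ℚ) (Cauchy-const 0ℚ)

_+ᴿ_ : ℝ → ℝ → ℝ
x +ᴿ y = lim (λ n → seq x n + seq y n) (Cauchy-+ (seq x) (seq y) (cauchy x) (cauchy y))

_·_ : ℚ → ℝ → ℝ
c · x = lim (λ n → c * seq x n) (Cauchy-* c (seq x) (cauchy x))

∑-over : {A : Set} → List A → (A → ℝ) → ℝ
∑-over as f = foldr _+ᴿ_ 0ᴿ (List.map f as)

infix 3 ∑-over
syntax ∑-over as (λ a → x) = ∑[ a ∈ as ] x

∑≤ : ℕ → (ℕ⁺ → ℚ) → ℚ
∑≤ zero    f = 0ℚ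
∑≤ (suc N) f = ∑≤ N f + f ⟨ suc N ⟩

Summable : (ℕ⁺ → ℚ) → Set
Summable f = Cauchy (λ N → ∑≤ N f)

-- The sum of a series is the real number represented by its partial sums.
∑∞ : (f : ℕ⁺ → ℚ) → Summable f → ℝ
∑∞ f f-summable = lim (λ N → ∑≤ N f) f-summable

infix 8 _^-_

_^-_ : ℕ⁺ → ℕ⁺ → ℚ
⟨ n ⟩ ^- ⟨ s ⟩ = (+ 1 / (n ℕ.^ s)) {{ℕ.m^n≢0 n s}}

H : ℕ → ℕ⁺ → ℚ
H n r = ∑≤ n (λ k → k ^- r)

-- ζ≤ N (s₁ ∷ ⋯ ∷ sₖ ∷ []) is the sum of n₁^-s₁ ⋯ nₖ^-sₖ over N ≥ n₁ > ⋯ > nₖ ≥ 1.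
ζ≤ : ℕ → List ℕ⁺ → ℚ
ζ≤ N []       = 1ℚ
ζ≤ N (s ∷ ss) = ∑≤ N (λ n → n ^- s * ζ≤ (pred (value n)) ss)

ζ-term : List⁺ ℕ⁺ → ℕ⁺ → ℚ
ζ-term (s ∷ ss) n = n ^- s * ζ≤ (pred (value n)) ss

S-term : (r m q : ℕ⁺) → ℕ⁺ → ℚ
S-term r m q n = H (value n) r ^ value m * n ^- q

-- Convergence of both series.  With L₀(n) = 1 and Lₖ₊₁(n) = ∑_{i ≤ n} Lₖ(i)/i, both kinds of
-- terms are bounded by a multiple of Lₖ(n)/n² for some k.  Summation by parts,
--   ∑_{n ≤ N} Lₖ₊₁(n)/(n(n+1)) = ∑_{n ≤ N} Lₖ(n)/n² - Lₖ₊₁(N)/(N+1),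
-- shows by induction that ∑ Lₖ(n)/n² converges.

u : ℕ → ℚ
u n = + 1 / suc n

ι : ℕ → ℚ
ι zero    = 0ℚ
ι (suc n) = ι n + 1ℚ

u-mkℚ : ∀ n → u n ≡ mkℚ (+ 1) n (1-coprimeTo (suc n))
u-mkℚ n = normalize-coprime (1-coprimeTo (suc n))

ι-mkℚ : ∀ n → ι n ≡ mkℚ (+ n) 0 (Coprime.sym (1-coprimeTo n))
ι-mkℚ zero    = refl
ι-mkℚ (suc n) rewrite ι-mkℚ n = trans
  (cong (_/ 1) {x = + n ℤ.* + 1 ℤ.+ + 1 ℤ.* + 1} {y = + suc n}
    (trans (cong (ℤ._+ + 1) (ℤ.*-identityʳ (+ n))) (cong +_ (ℕ.+-comm n 1))))
  (normalize-coprime (Coprime.sym (1-coprimeTo (suc n))))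

ι*u : ∀ n → ι (suc n) * u n ≡ 1ℚ
ι*u n = trans (cong₂ _*_ (ι-mkℚ (suc n)) (u-mkℚ n))
  (*-inverseʳ (mkℚ (+ suc n) 0 (Coprime.sym (1-coprimeTo (suc n)))))

u-anti : ∀ {m n} → m ℕ.≤ n → u n ≤ u m
u-anti {m} {n} m≤n rewrite u-mkℚ m | u-mkℚ n =
  *≤* (subst₂ ℤ._≤_ (sym (ℤ.*-identityˡ _)) (sym (ℤ.*-identityˡ _)) (ℤ.+≤+ (s≤s m≤n)))

0≤u : ∀ n → 0ℚ ≤ u n
0≤u n rewrite u-mkℚ n = nonNegative⁻¹ (mkℚ (+ 1) n (1-coprimeTo (suc n)))

u-null : Null u
u-null ε@(mkℚ +[1+ p ] d _) 0<ε = suc d , λ n d<n → begin-strict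
  ∣ u n ∣  ≡⟨ 0≤p⇒∣p∣≡p (0≤u n) ⟩
  u n      ≡⟨ u-mkℚ n ⟩
  mkℚ (+ 1) n (1-coprimeTo (suc n))
           <⟨ *<* (ℤ.+<+ (s≤s (ℕ.≤-trans
                 (ℕ.≤-reflexive (ℕ.+-identityʳ (suc d)))
                 (ℕ.≤-trans d<n (ℕ.m≤m+n n (p ℕ.* suc n)))))) ⟩
  ε        ∎
  where open ≤-Reasoning
u-null (mkℚ (+ 0) d _)        (*<* (ℤ.+<+ ()))
u-null (mkℚ (ℤ.-[1+ _ ]) d _) (*<* ())

ι*u≤1 : ∀ n → ι n * u n ≤ 1ℚ
ι*u≤1 n = begin
  ι n * u n        ≤⟨ *-monoʳ-≤-nonNeg (u n) {{nonNegative (0≤u n)}} ιn≤ ⟩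
  ι (suc n) * u n  ≡⟨ ι*u n ⟩
  1ℚ               ∎
  where
  open ≤-Reasoning
  ιn≤ : ι n ≤ ι n + 1ℚ
  ιn≤ = subst (_≤ ι n + 1ℚ) (+-identityʳ (ι n)) (+-monoʳ-≤ (ι n) (nonNegative⁻¹ 1ℚ))

u-telescope : ∀ n → u n - u (suc n) ≡ u n * u (suc n)
u-telescope n = begin
  r - s                                    ≡⟨ solve 2 (λ r s → r :- s := r :* con 1ℚ :- s :* con 1ℚ) refl r s ⟩
  r * 1ℚ - s * 1ℚ                          ≡⟨ cong₂ (λ a b → r * a - s * b) (ι*u (suc n)) (ι*u n) ⟨
  r * ((ι (suc n) + 1ℚ) * s) - s * (ι (suc n) * r)
                                           ≡⟨ solve 3 (λ r s i → r :* ((i :+ con 1ℚ) :* s) :- s :* (i :* r) := r :* s)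
                                                refl r s (ι (suc n)) ⟩
  r * s                                    ∎
  where
  open ≡-Reasoning
  r = u n
  s = u (suc n)

2ℚ : ℚ
2ℚ = 1ℚ + 1ℚ

0≤1 : 0ℚ ≤ 1ℚ
0≤1 = nonNegative⁻¹ 1ℚ

0≤2 : 0ℚ ≤ 2ℚ
0≤2 = nonNegative⁻¹ 2ℚ

0≤ι : ∀ n → 0ℚ ≤ ι n
0≤ι zero    = ≤-refl
0≤ι (suc n) = 0≤-+ (0≤ι n) 0≤1

p≤∣p∣ : ∀ p → p ≤ ∣ p ∣
p≤∣p∣ p = [ (λ 0≤p → ≤-reflexive (sym (0≤p⇒∣p∣≡p 0≤p))) , (λ p≤0 → ≤-trans p≤0 (0≤∣p∣ p)) ]′ (≤-total 0ℚ p)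

u≤2u : ∀ n → u n ≤ 2ℚ * u (suc n)
u≤2u n = begin
  r            ≡⟨ solve 2 (λ r s → r := (r :- s) :+ s) refl r s ⟩
  (r - s) + s  ≡⟨ cong (_+ s) (u-telescope n) ⟩
  r * s + s    ≤⟨ +-monoˡ-≤ s (*-monoʳ-≤-nonNeg s {{nonNegative (0≤u (suc n))}} (u-anti {0} {n} z≤n)) ⟩
  1ℚ * s + s   ≡⟨ solve 1 (λ s → con 1ℚ :* s :+ s := con 2ℚ :* s) refl s ⟩
  2ℚ * s       ∎
  where
  open ≤-Reasoning
  r = u n
  s = u (suc n)

recip-bounded : ∀ n d .{{_ : NonZero d}} → suc n ℕ.≤ d → 0ℚ ≤ + 1 / d × + 1 / d ≤ u n
recip-bounded n (suc d) (s≤s n≤d) = 0≤u d , u-anti n≤d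

^-bounded : ∀ n s → 0ℚ ≤ ⟨ suc n ⟩ ^- s × ⟨ suc n ⟩ ^- s ≤ u n
^-bounded n ⟨ suc s ⟩ = recip-bounded n (suc n ℕ.^ suc s) {{ℕ.m^n≢0 (suc n) (suc s)}}
  (ℕ.m≤m*n (suc n) (suc n ℕ.^ s) {{ℕ.m^n≢0 (suc n) s}})

u*u : ∀ m n → u m * u n ≡ + 1 / (suc m ℕ.* suc n)
u*u m n rewrite u-mkℚ m | u-mkℚ n = refl

^-bounded² : ∀ n s → 1 ℕ.< value s → ⟨ suc n ⟩ ^- s ≤ u n * u n
^-bounded² n ⟨ suc zero ⟩    (s≤s ())
^-bounded² n ⟨ suc (suc s) ⟩ _ = subst (⟨ suc n ⟩ ^- ⟨ suc (suc s) ⟩ ≤_) (sym (u*u n n))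
  (proj₂ (recip-bounded (n ℕ.+ n ℕ.* suc n) (suc n ℕ.^ suc (suc s)) {{ℕ.m^n≢0 (suc n) (suc (suc s))}}
    (ℕ.*-monoʳ-≤ (suc n) (ℕ.m≤m*n (suc n) (suc n ℕ.^ s) {{ℕ.m^n≢0 (suc n) s}}))))

∑≤-nonneg : ∀ {f} → (∀ n → 0ℚ ≤ f ⟨ suc n ⟩) → ∀ N → 0ℚ ≤ ∑≤ N f
∑≤-nonneg 0≤f zero    = ≤-refl
∑≤-nonneg 0≤f (suc N) = 0≤-+ (∑≤-nonneg 0≤f N) (0≤f N)

∑≤-mono : ∀ {f g} → (∀ n → f ⟨ suc n ⟩ ≤ g ⟨ suc n ⟩) → ∀ N → ∑≤ N f ≤ ∑≤ N g
∑≤-mono f≤g zero    = ≤-refl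
∑≤-mono f≤g (suc N) = +-mono-≤ (∑≤-mono f≤g N) (f≤g N)

∑≤-grows : ∀ {f} → (∀ n → 0ℚ ≤ f ⟨ suc n ⟩) → ∀ N → ∑≤ N f ≤ ∑≤ (suc N) f
∑≤-grows {f} 0≤f N = subst (_≤ ∑≤ (suc N) f) (+-identityʳ (∑≤ N f)) (+-monoʳ-≤ (∑≤ N f) (0≤f N))

summable-≤ : ∀ {f g} c → (∀ n → 0ℚ ≤ f ⟨ suc n ⟩) → (∀ n → f ⟨ suc n ⟩ ≤ c * g ⟨ suc n ⟩) →
             Summable g → Summable f
summable-≤ {f} {g} c 0≤f f≤cg g-summable ε 0<ε =
  let N , gN = Cauchy-* c (λ N → ∑≤ N g) g-summable ε 0<ε
  in N , λ m n N≤m N≤n →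
    [ (λ m≤n → subst (_< ε) (∣-∣-comm (∑≤ n f) (∑≤ m f))
                 (≤-<-trans (bound (ℕ.≤⇒≤′ m≤n)) (gN n m N≤n N≤m)))
    , (λ n≤m → ≤-<-trans (bound (ℕ.≤⇒≤′ n≤m)) (gN m n N≤m N≤n))
    ]′ (ℕ.≤-total m n)
  where
  ∣-∣-comm : ∀ a b → ∣ a - b ∣ ≡ ∣ b - a ∣
  ∣-∣-comm a b = trans (sym (∣-p∣≡∣p∣ (a - b)))
    (cong ∣_∣ (solve 2 (λ a b → :- (a :- b) := b :- a) refl a b))
  shift : ∀ a b d → (a - d) + b ≡ (a + b) - d
  shift = solve 3 (λ a b d → (a :- d) :+ b := (a :+ b) :- d) refl
  shift* : ∀ c a b d → (c * a - c * d) + c * b ≡ c * (a + b) - c * d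
  shift* = solve 4 (λ c a b d → (c :* a :- c :* d) :+ c :* b := c :* (a :+ b) :- c :* d) refl
  0≤tail : ∀ {m n} → m ℕ.≤′ n → 0ℚ ≤ ∑≤ n f - ∑≤ m f
  0≤tail {m} ℕ.≤′-refl               = ≤-reflexive (sym (+-inverseʳ (∑≤ m f)))
  0≤tail {m} {suc n} (ℕ.≤′-step m≤n) =
    subst (0ℚ ≤_) (shift (∑≤ n f) (f ⟨ suc n ⟩) (∑≤ m f)) (0≤-+ (0≤tail m≤n) (0≤f n))
  tail≤ : ∀ {m n} → m ℕ.≤′ n → ∑≤ n f - ∑≤ m f ≤ c * ∑≤ n g - c * ∑≤ m g
  tail≤ {m} ℕ.≤′-refl               =
    ≤-reflexive (trans (+-inverseʳ (∑≤ m f)) (sym (+-inverseʳ (c * ∑≤ m g))))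
  tail≤ {m} {suc n} (ℕ.≤′-step m≤n) = subst₂ _≤_
    (shift (∑≤ n f) (f ⟨ suc n ⟩) (∑≤ m f))
    (shift* c (∑≤ n g) (g ⟨ suc n ⟩) (∑≤ m g))
    (+-mono-≤ (tail≤ m≤n) (f≤cg n))
  bound : ∀ {m n} → m ℕ.≤′ n → ∣ ∑≤ n f - ∑≤ m f ∣ ≤ ∣ c * ∑≤ n g - c * ∑≤ m g ∣
  bound m≤n = subst₂ _≤_
    (sym (0≤p⇒∣p∣≡p (0≤tail m≤n)))
    (sym (0≤p⇒∣p∣≡p (≤-trans (0≤tail m≤n) (tail≤ m≤n))))
    (tail≤ m≤n)

L : ℕ → ℕ → ℚ
L zero    n = 1ℚ
L (suc k) n = ∑≤ n (λ i → L k (value i) * u (pred (value i)))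

0≤L : ∀ k n → 0ℚ ≤ L k n
0≤L zero    n = 0≤1
0≤L (suc k) n = ∑≤-nonneg (λ i → 0≤-* (0≤L k (suc i)) (0≤u i)) n

L-grows : ∀ k n → L k n ≤ L k (suc n)
L-grows zero    n = ≤-refl
L-grows (suc k) n = ∑≤-grows (λ i → 0≤-* (0≤L k (suc i)) (0≤u i)) n

-- Lₖ(n)/(n+1) → 0: the terms of Lₖ₊₁(n) = ∑_{i ≤ n} Lₖ(i)/i tend to 0, so their
-- averages do.
L-null : ∀ k → Null (λ n → L k n * u n)
L-null zero    ε 0<ε = let N , uN = u-null ε 0<ε in
  N , λ n N≤n → subst (λ p → ∣ p ∣ < ε) (sym (*-identityˡ (u n))) (uN n N≤n)
L-null (suc k) ε 0<ε =
  let N , LN = L-null k (½ * δ) (half-pos 0<δ)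
      M , uM = Null-* (L (suc k) N) u u-null δ 0<δ
  in N ℕ.+ M , λ n N+M≤n → late n (L (suc k) N)
       (early N (λ n N≤n → term n (LN (suc n) N≤n)) (ℕ.≤⇒≤′ (ℕ.m+n≤o⇒m≤o N N+M≤n)))
       (uM n (ℕ.m+n≤o⇒n≤o N N+M≤n))
  where
  open ≤-Reasoning
  δ : ℚ
  δ = ½ * ε
  0<δ : 0ℚ < δ
  0<δ = half-pos 0<ε
  0≤δ : 0ℚ ≤ δ
  0≤δ = <⇒≤ 0<δ
  term : ∀ n → ∣ L k (suc n) * u (suc n) ∣ < ½ * δ → L k (suc n) * u n ≤ δ
  term n Lu< = begin
    L k (suc n) * u n                 ≤⟨ *-monoˡ-≤-nonNeg (L k (suc n)) {{nonNegative (0≤L k (suc n))}} (u≤2u n) ⟩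
    L k (suc n) * (2ℚ * u (suc n))    ≡⟨ solve 2 (λ l s → l :* (con 2ℚ :* s) := con 2ℚ :* (l :* s))
                                           refl (L k (suc n)) (u (suc n)) ⟩
    2ℚ * (L k (suc n) * u (suc n))    ≤⟨ *-monoˡ-≤-nonNeg 2ℚ (<⇒≤ (subst (_< ½ * δ)
                                           (0≤p⇒∣p∣≡p (0≤-* (0≤L k (suc n)) (0≤u (suc n)))) Lu<)) ⟩
    2ℚ * (½ * δ)                      ≡⟨ trans (sym (*-assoc 2ℚ ½ δ)) (*-identityˡ δ) ⟩
    δ                                 ∎
  early : ∀ N → (∀ n → N ℕ.≤ suc n → L k (suc n) * u n ≤ δ) →
          ∀ {n} → N ℕ.≤′ n → L (suc k) n ≤ L (suc k) N + δ * ι n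
  early N term≤ ℕ.≤′-refl =
    subst (_≤ L (suc k) N + δ * ι N) (+-identityʳ (L (suc k) N))
          (+-monoʳ-≤ (L (suc k) N) (0≤-* 0≤δ (0≤ι N)))
  early N term≤ {suc n} (ℕ.≤′-step N≤n) = begin
    L (suc k) n + L k (suc n) * u n      ≤⟨ +-mono-≤ (early N term≤ N≤n) (term≤ n (ℕ.m≤n⇒m≤1+n (ℕ.≤′⇒≤ N≤n))) ⟩
    (L (suc k) N + δ * ι n) + δ          ≡⟨ solve 3 (λ B δ i → (B :+ δ :* i) :+ δ := B :+ δ :* (i :+ con 1ℚ))
                                              refl (L (suc k) N) δ (ι n) ⟩
    L (suc k) N + δ * (ι n + 1ℚ)         ∎
  late : ∀ n B → L (suc k) n ≤ B + δ * ι n → ∣ B * u n ∣ < δ → ∣ L (suc k) n * u n ∣ < ε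
  late n B L≤ Bu< = begin-strict
    ∣ L (suc k) n * u n ∣         ≡⟨ 0≤p⇒∣p∣≡p (0≤-* (0≤L (suc k) n) (0≤u n)) ⟩
    L (suc k) n * u n             ≤⟨ *-monoʳ-≤-nonNeg (u n) {{nonNegative (0≤u n)}} L≤ ⟩
    (B + δ * ι n) * u n           ≡⟨ solve 4 (λ B δ i r → (B :+ δ :* i) :* r := B :* r :+ δ :* (i :* r))
                                       refl B δ (ι n) (u n) ⟩
    B * u n + δ * (ι n * u n)     ≤⟨ +-mono-≤ (p≤∣p∣ (B * u n))
                                       (*-monoˡ-≤-nonNeg δ {{nonNegative 0≤δ}} (ι*u≤1 n)) ⟩
    ∣ B * u n ∣ + δ * 1ℚ          ≡⟨ cong (λ p → ∣ B * u n ∣ + p) (*-identityʳ δ) ⟩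
    ∣ B * u n ∣ + δ               <⟨ +-monoˡ-< δ Bu< ⟩
    δ + δ                         ≡⟨ halves ε ⟩
    ε                             ∎

Null⇒Cauchy : ∀ x → Null x → Cauchy x
Null⇒Cauchy x nx ε 0<ε with nx (½ * ε) (half-pos 0<ε)
... | N , xN = N , λ m n N≤m N≤n → begin-strict
  ∣ x m - x n ∣      ≤⟨ ∣p-q∣≤∣p∣+∣q∣ (x m) (x n) ⟩
  ∣ x m ∣ + ∣ x n ∣  <⟨ +-mono-< (xN m N≤m) (xN n N≤n) ⟩
  ½ * ε + ½ * ε      ≡⟨ halves ε ⟩
  ε                  ∎
  where open ≤-Reasoning

Cauchy-resp : ∀ {x y} → (∀ n → x n ≡ y n) → Cauchy x → Cauchy y
Cauchy-resp x≡y cx ε 0<ε with cx ε 0<ε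
... | N , xN = N , λ m n N≤m N≤n →
  subst₂ (λ a b → ∣ a - b ∣ < ε) (x≡y m) (x≡y n) (xN m n N≤m N≤n)

L/n² L/n[n+1] : ℕ → ℕ⁺ → ℚ
L/n²     k n = L k (value n) * (u (pred (value n)) * u (pred (value n)))
L/n[n+1] k n = L k (value n) * (u (pred (value n)) * u (value n))

∑L/n[n+1] : ∀ k N → ∑≤ N (L/n² k) + - 1ℚ * (L (suc k) N * u N) ≡ ∑≤ N (L/n[n+1] (suc k))
∑L/n[n+1] k zero    = refl
∑L/n[n+1] k (suc N) = begin
  (A + a * (r * r)) + - 1ℚ * ((B + a * r) * s)
    ≡⟨ solve 5 (λ A B a r s →
         (A :+ a :* (r :* r)) :+ con (- 1ℚ) :* ((B :+ a :* r) :* s) :=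
         (A :+ con (- 1ℚ) :* (B :* r)) :+ (B :+ a :* r) :* (r :- s)) refl A B a r s ⟩
  (A + - 1ℚ * (B * r)) + (B + a * r) * (r - s)
    ≡⟨ cong₂ (λ x y → x + (B + a * r) * y) (∑L/n[n+1] k N) (u-telescope N) ⟩
  ∑≤ N (L/n[n+1] (suc k)) + (B + a * r) * (r * s)
    ∎
  where
  open ≡-Reasoning
  A = ∑≤ N (L/n² k)
  B = L (suc k) N
  a = L k (suc N)
  r = u N
  s = u (suc N)

∑1/n[n+1] : ∀ N → 1ℚ + - 1ℚ * u N ≡ ∑≤ N (L/n[n+1] zero)
∑1/n[n+1] zero    = refl
∑1/n[n+1] (suc N) = begin
  1ℚ + - 1ℚ * s                     ≡⟨ solve 2 (λ r s → con 1ℚ :+ con (- 1ℚ) :* s :=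
                                         (con 1ℚ :+ con (- 1ℚ) :* r) :+ con 1ℚ :* (r :- s)) refl r s ⟩
  (1ℚ + - 1ℚ * r) + 1ℚ * (r - s)    ≡⟨ cong₂ (λ x y → x + 1ℚ * y) (∑1/n[n+1] N) (u-telescope N) ⟩
  ∑≤ N (L/n[n+1] zero) + 1ℚ * (r * s)  ∎
  where
  open ≡-Reasoning
  r = u N
  s = u (suc N)

L/n²-summable : ∀ k → Summable (L/n² k)
L/n²-summable k = summable-≤ 2ℚ
  (λ n → 0≤-* (0≤L k (suc n)) (0≤-* (0≤u n) (0≤u n)))
  (λ n → begin
    L k (suc n) * (u n * u n)                 ≤⟨ *-monoˡ-≤-nonNeg (L k (suc n)) {{nonNegative (0≤L k (suc n))}}
                                                   (*-monoˡ-≤-nonNeg (u n) {{nonNegative (0≤u n)}} (u≤2u n)) ⟩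
    L k (suc n) * (u n * (2ℚ * u (suc n)))    ≡⟨ solve 3 (λ l r s → l :* (r :* (con 2ℚ :* s)) := con 2ℚ :* (l :* (r :* s)))
                                                   refl (L k (suc n)) (u n) (u (suc n)) ⟩
    2ℚ * (L k (suc n) * (u n * u (suc n)))    ∎)
  (L/n[n+1]-summable k)
  where
  open ≤-Reasoning
  L/n[n+1]-summable : ∀ k → Summable (L/n[n+1] k)
  L/n[n+1]-summable zero    = Cauchy-resp ∑1/n[n+1]
    (Cauchy-+ (λ _ → 1ℚ) (λ N → - 1ℚ * u N) (Cauchy-const 1ℚ)
      (Cauchy-* (- 1ℚ) u (Null⇒Cauchy u u-null)))
  L/n[n+1]-summable (suc k) = Cauchy-resp (∑L/n[n+1] k)
    (Cauchy-+ (λ N → ∑≤ N (L/n² k)) (λ N → - 1ℚ * (L (suc k) N * u N)) (L/n²-summable k)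
      (Cauchy-* (- 1ℚ) (λ N → L (suc k) N * u N) (Null⇒Cauchy (λ N → L (suc k) N * u N) (L-null (suc k)))))

ζ≤-bounded : ∀ ss N → 0ℚ ≤ ζ≤ N ss × ζ≤ N ss ≤ L (List.length ss) N
ζ≤-bounded []       N = 0≤1 , ≤-refl
ζ≤-bounded (s ∷ ss) N =
  ∑≤-nonneg (λ n → 0≤-* (proj₁ (^-bounded n s)) (proj₁ (ζ≤-bounded ss n))) N ,
  ∑≤-mono (λ n → let 0≤r , r≤ = ^-bounded n s ; 0≤z , z≤ = ζ≤-bounded ss n in
    ≤-trans (*-mono₀-≤ 0≤r r≤ 0≤z (≤-trans z≤ (L-grows (List.length ss) n)))
            (≤-reflexive (*-comm (u n) (L (List.length ss) (suc n))))) N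

ζ-summable : ∀ s → 1 ℕ.< value (head s) → Summable (ζ-term s)
ζ-summable (s ∷ ss) 1<s = summable-≤ 1ℚ
  (λ n → 0≤-* (proj₁ (^-bounded n s)) (proj₁ (ζ≤-bounded ss n)))
  (λ n → let 0≤z , z≤ = ζ≤-bounded ss n in
    ≤-trans (*-mono₀-≤ (proj₁ (^-bounded n s)) (^-bounded² n s 1<s)
                       0≤z (≤-trans z≤ (L-grows (List.length ss) n)))
            (≤-reflexive (trans (*-comm (u n * u n) (L (List.length ss) (suc n)))
                                (sym (*-identityˡ (L/n² (List.length ss) ⟨ suc n ⟩))))))
  (L/n²-summable (List.length ss))

^-nonneg : ∀ {p} → 0ℚ ≤ p → ∀ m → 0ℚ ≤ p ^ m
^-nonneg 0≤p zero    = 0≤1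
^-nonneg 0≤p (suc m) = 0≤-* 0≤p (^-nonneg 0≤p m)

^-mono : ∀ {p q} → 0ℚ ≤ p → p ≤ q → ∀ m → p ^ m ≤ q ^ m
^-mono 0≤p p≤q zero    = ≤-refl
^-mono 0≤p p≤q (suc m) = *-mono₀-≤ 0≤p p≤q (^-nonneg 0≤p m) (^-mono 0≤p p≤q m)

^-increment : ∀ {x h} → 0ℚ ≤ x → 0ℚ ≤ h → ∀ m →
              (x + h) ^ suc m ≤ x ^ suc m + ι (suc m) * ((x + h) ^ m * h)
^-increment {x} {h} 0≤x 0≤h zero = ≤-reflexive
  (solve 2 (λ x h → (x :+ h) :* con 1ℚ := x :* con 1ℚ :+ con (ι 1) :* (con 1ℚ :* h)) refl x h)
^-increment {x} {h} 0≤x 0≤h (suc m) = begin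
  y * (y * Y)                                            ≤⟨ *-monoˡ-≤-nonNeg y {{nonNegative 0≤y}}
                                                              (^-increment 0≤x 0≤h m) ⟩
  y * (X + c * (Y * h))                                  ≡⟨ solve 5 (λ x h X Y c →
                                                              (x :+ h) :* (X :+ c :* (Y :* h)) :=
                                                              (x :* X :+ c :* (((x :+ h) :* Y) :* h)) :+ X :* h)
                                                              refl x h X Y c ⟩
  (x * X + c * ((y * Y) * h)) + X * h                    ≤⟨ +-monoʳ-≤ (x * X + c * ((y * Y) * h))
                                                              (*-monoʳ-≤-nonNeg h {{nonNegative 0≤h}}
                                                                (^-mono 0≤x x≤y (suc m))) ⟩
  (x * X + c * ((y * Y) * h)) + (y * Y) * h              ≡⟨ solve 3 (λ a c b →
                                                              (a :+ c :* b) :+ b := a :+ (c :+ con 1ℚ) :* b)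
                                                              refl (x * X) c ((y * Y) * h) ⟩
  x * X + (c + 1ℚ) * ((y * Y) * h)                       ∎
  where
  open ≤-Reasoning
  y = x + h
  Y = y ^ m
  X = x ^ suc m
  c = ι (suc m)
  0≤y : 0ℚ ≤ y
  0≤y = 0≤-+ 0≤x 0≤h
  x≤y : x ≤ y
  x≤y = subst (_≤ y) (+-identityʳ x) (+-monoʳ-≤ x 0≤h)

0≤H : ∀ n r → 0ℚ ≤ H n r
0≤H n r = ∑≤-nonneg (λ k → proj₁ (^-bounded k r)) n

H^-bounded : ∀ r m → ∃ λ c → 0ℚ ≤ c × (∀ n → H n r ^ m ≤ c * L m n)
H^-bounded r zero    = 1ℚ , 0≤1 , λ n → ≤-refl
H^-bounded r (suc m) = C , 0≤-* (0≤ι (suc m)) 0≤c , bound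
  where
  open ≤-Reasoning
  c C : ℚ
  c = proj₁ (H^-bounded r m)
  C = ι (suc m) * c
  0≤c : 0ℚ ≤ c
  0≤c = proj₁ (proj₂ (H^-bounded r m))
  c-bound : ∀ n → H n r ^ m ≤ c * L m n
  c-bound = proj₂ (proj₂ (H^-bounded r m))
  bound : ∀ n → H n r ^ suc m ≤ C * L (suc m) n
  bound zero    = ≤-reflexive (trans (*-zeroˡ (0ℚ ^ m)) (sym (*-zeroʳ C)))
  bound (suc n) = let 0≤h , h≤ = ^-bounded n r ; H′ = H (suc n) r ; h = ⟨ suc n ⟩ ^- r in begin
    H′ ^ suc m                                         ≤⟨ ^-increment (0≤H n r) 0≤h m ⟩
    H n r ^ suc m + ι (suc m) * (H′ ^ m * h)           ≤⟨ +-mono-≤ (bound n)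
                                                            (*-monoˡ-≤-nonNeg (ι (suc m)) {{nonNegative (0≤ι (suc m))}}
                                                              (*-mono₀-≤ (^-nonneg (0≤H (suc n) r) m) (c-bound (suc n))
                                                                         0≤h h≤)) ⟩
    C * L (suc m) n + ι (suc m) * ((c * L m (suc n)) * u n)
                                                       ≡⟨ solve 5 (λ i c l l′ r →
                                                            (i :* c) :* l :+ i :* ((c :* l′) :* r) :=
                                                            (i :* c) :* (l :+ l′ :* r))
                                                            refl (ι (suc m)) c (L (suc m) n) (L m (suc n)) (u n) ⟩
    C * (L (suc m) n + L m (suc n) * u n)              ∎

S-summable : ∀ r m q → 1 ℕ.< value q → Summable (S-term r m q)
S-summable r m q 1<q = let c , 0≤c , c-bound = H^-bounded r (value m) in summable-≤ c
  (λ n → 0≤-* (^-nonneg (0≤H (suc n) r) (value m)) (proj₁ (^-bounded n q)))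
  (λ n → ≤-trans
    (*-mono₀-≤ (^-nonneg (0≤H (suc n) r) (value m)) (c-bound (suc n))
               (proj₁ (^-bounded n q)) (^-bounded² n q 1<q))
    (≤-reflexive (*-assoc c (L (value m) (suc n)) (u n * u n))))
  (L/n²-summable (value m))

S : (r m q : ℕ⁺) → 1 ℕ.< value q → ℝ
S r m q 1<q = ∑∞ (S-term r m q) (S-summable r m q 1<q)

ζ : (s : List⁺ ℕ⁺) → 1 ℕ.< value (head s) → ℝ
ζ s 1<s = ∑∞ (ζ-term s) (ζ-summable s 1<s)

1<q⇒1<q+r : ∀ q r → 1 ℕ.< value q → 1 ℕ.< value (q +⁺ r)
1<q⇒1<q+r q r 1<q = ℕ.m≤n⇒m≤n+o (value r) 1<q

weight : List⁺ ℕ⁺ → ℕ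
weight ξ = sum (List.map value (toList ξ))

-- compositions≥ k n lists the compositions of 1 + k + n with first part at
-- least 1 + k.
compositions≥ : ℕ → ℕ → List (List⁺ ℕ⁺)
compositions≥ k zero    = [ ⟨ suc k ⟩ ] ∷ []
compositions≥ k (suc n) =
  List.map (⟨ suc k ⟩ ∷⁺_) (compositions≥ 0 n) ++ compositions≥ (suc k) n

compositions : ℕ⁺ → List (List⁺ ℕ⁺)
compositions m = compositions≥ 0 (pred (value m))

compositions≥-sound : ∀ k n {ξ} → ξ ∈ compositions≥ k n →
                      suc k ℕ.≤ value (head ξ) × weight ξ ≡ suc k ℕ.+ n
compositions≥-sound k zero    (here refl) = ℕ.≤-refl , refl
compositions≥-sound k (suc n) {ξ} ξ∈ with ∈-++⁻ (List.map (⟨ suc k ⟩ ∷⁺_) (compositions≥ 0 n)) ξ∈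
... | inj₁ ξ∈ˡ with ∈-map⁻ (⟨ suc k ⟩ ∷⁺_) ξ∈ˡ
...   | η , η∈ , refl = ℕ.≤-refl , cong (suc k ℕ.+_) (proj₂ (compositions≥-sound 0 n η∈))
compositions≥-sound k (suc n) {ξ} ξ∈ | inj₂ ξ∈ʳ = let k< , w≡ = compositions≥-sound (suc k) n ξ∈ʳ in
  ℕ.<⇒≤ k< , trans w≡ (cong suc (sym (ℕ.+-suc k n)))

compositions≥-complete : ∀ k n ξ → suc k ℕ.≤ value (head ξ) → weight ξ ≡ suc k ℕ.+ n →
                         ξ ∈ compositions≥ k n
compositions≥-complete k n (⟨ suc h ⟩ ∷ ξs) k<h w≡ with ℕ.≤⇒≤′ k<h
compositions≥-complete k n (⟨ suc .k ⟩ ∷ ξs) k<h w≡ | ℕ.≤′-refl =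
  exact n ξs (ℕ.+-cancelˡ-≡ (suc k) _ _ w≡)
  where
  exact : ∀ n ξs → sum (List.map value ξs) ≡ n → (⟨ suc k ⟩ ∷ ξs) ∈ compositions≥ k n
  exact zero    []               _  = here refl
  exact zero    (⟨ suc _ ⟩ ∷ _)  ()
  exact (suc n) (⟨ suc h ⟩ ∷ ξs) w≡ =
    ∈-++⁺ˡ (∈-map⁺ (⟨ suc k ⟩ ∷⁺_) (compositions≥-complete 0 n (⟨ suc h ⟩ ∷ ξs) (s≤s z≤n) w≡))
compositions≥-complete k zero (⟨ suc h ⟩ ∷ ξs) k<h w≡ | ℕ.≤′-step k<h′ =
  contradiction (ℕ.≤′⇒≤ k<h′) (ℕ.<⇒≱ (s≤s (ℕ.≤-trans (ℕ.m≤m+n h _)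
    (ℕ.≤-reflexive (trans (ℕ.suc-injective w≡) (ℕ.+-identityʳ k))))))
compositions≥-complete k (suc n) (⟨ suc h ⟩ ∷ ξs) k<h w≡ | ℕ.≤′-step k<h′ =
  ∈-++⁺ʳ (List.map (⟨ suc k ⟩ ∷⁺_) (compositions≥ 0 n))
    (compositions≥-complete (suc k) n (⟨ suc h ⟩ ∷ ξs) (s≤s (ℕ.≤′⇒≤ k<h′))
      (trans w≡ (cong suc (ℕ.+-suc k n))))

∈-compositions : ∀ m ξ → ξ ∈ compositions m ⇔ weight ξ ≡ value m
∈-compositions ⟨ suc m ⟩ ξ@(⟨ suc _ ⟩ ∷ _) = mk⇔
  (proj₂ ∘ compositions≥-sound 0 m)
  (compositions≥-complete 0 m ξ (s≤s z≤n))

compositions≥-unique : ∀ k n → Unique (compositions≥ k n)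
compositions≥-unique k zero    = [] ∷ []
compositions≥-unique k (suc n) = Unique.++⁺
  (Unique.map⁺ (λ { {_ ∷ _} {_ ∷ _} refl → refl }) (compositions≥-unique 0 n))
  (compositions≥-unique (suc k) n)
  λ (ξ∈ˡ , ξ∈ʳ) → case ∈-map⁻ (⟨ suc k ⟩ ∷⁺_) ξ∈ˡ of λ where
    (_ , _ , refl) → ℕ.<-irrefl refl (proj₁ (compositions≥-sound (suc k) n ξ∈ʳ))

compositions-unique : ∀ m → Unique (compositions m)
compositions-unique m = compositions≥-unique 0 (pred (value m))

factorials≢0 : (ξs : List ℕ) → All NonZero (List.map _! ξs)
factorials≢0 []       = []
factorials≢0 (k ∷ ks) = (k ℕ.!≢0) ∷ factorials≢0 ks

-- Only meant for weight ξ ≡ value m, where the quotient is an integer.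
multinomial : ℕ⁺ → List⁺ ℕ⁺ → ℚ
multinomial m ξ =
  (+ (value m !) / product (List.map _! parts)) {{product≢0 (factorials≢0 parts)}}
  where parts = List.map value (toList ξ)

-- The identity already holds between the N-th partial sums. Since
-- ζ≤ n (s ∷ ss) = ζ≤ (n - 1) (s ∷ ss) + n^-s ζ≤ (n - 1) ss, the two zeta terms of ξ add up to
-- n^-q ζ≤ n (r ξ₁, …, r ξₚ), so what remains is H n r ^ m = ∑ multinomial m ξ ζ≤ n (r ξ).
-- Divided by m!, the right-hand side cₘ(n) = ∑ ζ≤ n (r ξ) / ∏ ξᵢ! satisfies, on splitting off the
-- first part j of ξ, cₘ(n) = ∑_{0 ≤ j ≤ m} (n^-r)^j/j! cₘ₋ⱼ(n - 1). The divided power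
-- H n r ^ m / m! satisfies the same recursion by the binomial theorem.
module Submission where

open import Defs
open import Data.List.Base using (map)
open import Data.List.NonEmpty using (_∷_; _∷⁺_; head; tail) renaming (map to map⁺)
open import Data.Nat.Base using (_<_)

import Data.Integer.Base as ℤ
import Data.Integer.Properties as ℤ
open import Data.List.Base using (List; []; _∷_; _++_; foldr)
open import Data.List.NonEmpty using (List⁺; toList)
open import Data.Nat.Base as ℕ using (ℕ; zero; suc; NonZero; _!)
open import Data.Nat.ListAction using (product)
open import Data.Nat.ListAction.Properties using (product≢0)
import Data.Nat.Properties as ℕ
open import Data.Rational.Base using (ℚ; 0ℚ; 1ℚ; _+_; _*_; _/_; ∣_∣)
import Data.Rational.Base as ℚ
open import Data.Rational.Properties
open import Data.Rational.Solver using (module +-*-Solver)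
open import Data.Product.Base using (_,_)
open import Relation.Binary.PropositionalEquality
  using (_≡_; refl; sym; trans; cong; cong₂; subst; module ≡-Reasoning)
open +-*-Solver using (solve; _:+_; _:*_; _:=_; con)
open ≡-Reasoning

-- Embedding of naturals, reciprocals and negative powers.

ι-+ : ∀ m n → ι (m ℕ.+ n) ≡ ι m + ι n
ι-+ zero    n = sym (+-identityˡ (ι n))
ι-+ (suc m) n = trans (cong (_+ 1ℚ) (ι-+ m n))
  (solve 2 (λ a b → (a :+ b) :+ con 1ℚ := (a :+ con 1ℚ) :+ b) refl (ι m) (ι n))

ι-* : ∀ m n → ι (m ℕ.* n) ≡ ι m * ι n
ι-* zero    n = sym (*-zeroˡ (ι n))
ι-* (suc m) n = begin
  ι (n ℕ.+ m ℕ.* n)   ≡⟨ ι-+ n (m ℕ.* n) ⟩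
  ι n + ι (m ℕ.* n)   ≡⟨ cong (ι n +_) (ι-* m n) ⟩
  ι n + ι m * ι n     ≡⟨ solve 2 (λ a b → b :+ a :* b := (a :+ con 1ℚ) :* b) refl (ι m) (ι n) ⟩
  (ι m + 1ℚ) * ι n    ∎

recip : (n : ℕ) .{{_ : NonZero n}} → ℚ
recip n = ℤ.+ 1 / n

-- `NonZero` arguments are irrelevant, so identifying the denominators suffices; `cong recip` could
-- not carry these arguments along.
recip-cong : ∀ {m n} .{{_ : NonZero m}} .{{_ : NonZero n}} → m ≡ n → recip m ≡ recip n
recip-cong refl = refl

recip-* : ∀ m n .{{_ : NonZero m}} .{{_ : NonZero n}} →
          recip (m ℕ.* n) {{ℕ.m*n≢0 m n}} ≡ recip m * recip n
recip-* (suc m) (suc n) = sym (u*u m n)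

recip-^ : ∀ m n .{{_ : NonZero m}} → recip (m ℕ.^ n) {{ℕ.m^n≢0 m n}} ≡ recip m ^ n
recip-^ m zero    = refl
recip-^ m (suc n) {{m≢0}} = trans (recip-* m (m ℕ.^ n) {{m≢0}} {{ℕ.m^n≢0 m n}}) (cong (recip m *_) (recip-^ m n))

/-recip : ∀ m n .{{_ : NonZero n}} → ℤ.+ m / n ≡ ι m * recip n
/-recip m (suc n) rewrite ι-mkℚ m | u-mkℚ n =
  -- In `mkℚ` form the product unfolds to `(m * 1) / (1 * suc n)`.
  /-cong (sym (ℤ.*-identityʳ (ℤ.+ m))) (sym (ℕ.*-identityˡ (suc n)))

^-+ : ∀ n s t → n ^- (s +⁺ t) ≡ n ^- s * n ^- t
^-+ ⟨ n ⟩ ⟨ s ⟩ ⟨ t ⟩ = trans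
  (recip-cong {{ℕ.m^n≢0 n (s ℕ.+ t)}} {{ℕ.m*n≢0 _ _ {{ℕ.m^n≢0 n s}} {{ℕ.m^n≢0 n t}}}}
    (ℕ.^-distribˡ-+-* n s t))
  (recip-* (n ℕ.^ s) (n ℕ.^ t) {{ℕ.m^n≢0 n s}} {{ℕ.m^n≢0 n t}})

^-* : ∀ n s t → n ^- (s *⁺ t) ≡ (n ^- s) ^ value t
^-* ⟨ n ⟩ ⟨ s ⟩ ⟨ t ⟩ = trans
  (recip-cong {{ℕ.m^n≢0 n (s ℕ.* t)}} {{ℕ.m^n≢0 (n ℕ.^ s) t {{ℕ.m^n≢0 n s}}}}
    (sym (ℕ.^-*-assoc n s t)))
  (recip-^ (n ℕ.^ s) t {{ℕ.m^n≢0 n s}})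

-- Finite rational sums over lists.

∑ℚ : {A : Set} → List A → (A → ℚ) → ℚ
∑ℚ as f = foldr _+_ 0ℚ (map f as)

seq-∑-over : ∀ {A : Set} (as : List A) (f : A → ℝ) n →
             seq (∑-over as f) n ≡ ∑ℚ as (λ a → seq (f a) n)
seq-∑-over []       f n = refl
seq-∑-over (a ∷ as) f n = cong (seq (f a) n +_) (seq-∑-over as f n)

module _ {A : Set} where

  ∑ℚ-cong : ∀ (as : List A) {f g} → (∀ a → f a ≡ g a) → ∑ℚ as f ≡ ∑ℚ as g
  ∑ℚ-cong []       f≡g = refl
  ∑ℚ-cong (a ∷ as) f≡g = cong₂ _+_ (f≡g a) (∑ℚ-cong as f≡g)

  ∑ℚ-zero : ∀ (as : List A) → ∑ℚ as (λ _ → 0ℚ) ≡ 0ℚ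
  ∑ℚ-zero []       = refl
  ∑ℚ-zero (a ∷ as) = trans (+-identityˡ _) (∑ℚ-zero as)

  ∑ℚ-+ : ∀ (as : List A) f g → ∑ℚ as (λ a → f a + g a) ≡ ∑ℚ as f + ∑ℚ as g
  ∑ℚ-+ []       f g = refl
  ∑ℚ-+ (a ∷ as) f g = trans (cong (f a + g a +_) (∑ℚ-+ as f g))
    (solve 4 (λ a b c d → (a :+ b) :+ (c :+ d) := (a :+ c) :+ (b :+ d)) refl
      (f a) (g a) (∑ℚ as f) (∑ℚ as g))

  ∑ℚ-*ˡ : ∀ c (as : List A) f → ∑ℚ as (λ a → c * f a) ≡ c * ∑ℚ as f
  ∑ℚ-*ˡ c []       f = sym (*-zeroʳ c)
  ∑ℚ-*ˡ c (a ∷ as) f = trans (cong (c * f a +_) (∑ℚ-*ˡ c as f))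
    (sym (*-distribˡ-+ c (f a) (∑ℚ as f)))

  ∑ℚ-++ : ∀ (as bs : List A) f → ∑ℚ (as ++ bs) f ≡ ∑ℚ as f + ∑ℚ bs f
  ∑ℚ-++ []       bs f = sym (+-identityˡ (∑ℚ bs f))
  ∑ℚ-++ (a ∷ as) bs f = trans (cong (f a +_) (∑ℚ-++ as bs f))
    (sym (+-assoc (f a) (∑ℚ as f) (∑ℚ bs f)))

∑ℚ-map : ∀ {A B : Set} (h : A → B) as f → ∑ℚ (map h as) f ≡ ∑ℚ as (λ a → f (h a))
∑ℚ-map h []       f = refl
∑ℚ-map h (a ∷ as) f = cong (f (h a) +_) (∑ℚ-map h as f)

-- Truncated convolutions and the product rule.

-- conv f g k n is the sum of f i * g j over i + j = k + n with i ≥ k, recursing like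
-- compositions≥ k n.
conv : (f g : ℕ → ℚ) → ℕ → ℕ → ℚ
conv f g k zero    = f k * g 0
conv f g k (suc n) = f k * g (suc n) + conv f g (suc k) n

conv-congʳ : ∀ f {g h} → (∀ i → g i ≡ h i) → ∀ k n → conv f g k n ≡ conv f h k n
conv-congʳ f g≡h k zero    = cong (f k *_) (g≡h 0)
conv-congʳ f g≡h k (suc n) = cong₂ (λ a b → f k * a + b) (g≡h (suc n)) (conv-congʳ f g≡h (suc k) n)

-- θ f are the coefficients of t F′(t), where F is the generating function of f.
θ : (ℕ → ℚ) → ℕ → ℚ
θ f n = ι n * f n

-- Product rule for `t d/dt`: the weight `k + n = i + j` of each summand splits between its two
-- factors, and the bound `i ≥ k` is unaffected.
θ-conv : ∀ f g k n → ι (k ℕ.+ n) * conv f g k n ≡ conv (θ f) g k n + conv f (θ g) k n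
θ-conv f g k zero rewrite ℕ.+-identityʳ k =
  solve 3 (λ i a b → i :* (a :* b) := (i :* a) :* b :+ a :* (con 0ℚ :* b)) refl (ι k) (f k) (g 0)
θ-conv f g k (suc n) = begin
  ι (k ℕ.+ suc n) * (f k * g (suc n) + C)
    ≡⟨ *-distribˡ-+ (ι (k ℕ.+ suc n)) (f k * g (suc n)) C ⟩
  ι (k ℕ.+ suc n) * (f k * g (suc n)) + ι (k ℕ.+ suc n) * C
    ≡⟨ cong₂ _+_ (cong (_* (f k * g (suc n))) (ι-+ k (suc n)))
        (trans (cong (λ i → ι i * C) (ℕ.+-suc k n)) (θ-conv f g (suc k) n)) ⟩
  (ι k + ι (suc n)) * (f k * g (suc n)) + (A + B)
    ≡⟨ solve 6 (λ i j a b A B →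
         (i :+ j) :* (a :* b) :+ (A :+ B) := ((i :* a) :* b :+ A) :+ (a :* (j :* b) :+ B))
         refl (ι k) (ι (suc n)) (f k) (g (suc n)) A B ⟩
  ((ι k * f k) * g (suc n) + A) + (f k * (ι (suc n) * g (suc n)) + B) ∎
  where
  A = conv (θ f) g (suc k) n
  B = conv f (θ g) (suc k) n
  C = conv f g (suc k) n

-- Divided powers and the binomial theorem.

infix 8 _^[_]

-- For fixed `x`, the coefficients of `exp(xt)`.
_^[_] : ℚ → ℕ → ℚ
x ^[ n ] = x ^ n * recip (n !) {{n ℕ.!≢0}}

^[]-suc : ∀ x n → x ^[ suc n ] ≡ u n * (x * x ^[ n ])
^[]-suc x n = begin
  x * x ^ n * recip (suc n ℕ.* n !) {{suc n ℕ.!≢0}}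
    ≡⟨ cong (x * x ^ n *_) (recip-* (suc n) (n !) {{_}} {{n ℕ.!≢0}}) ⟩
  x * x ^ n * (u n * w)
    ≡⟨ solve 4 (λ x y u w → x :* y :* (u :* w) := u :* (x :* (y :* w))) refl x (x ^ n) (u n) w ⟩
  u n * (x * (x ^ n * w)) ∎
  where w = recip (n !) {{n ℕ.!≢0}}

-- The differential equation `t F′ = x t F` of `F = exp(xt)`, read off at degree `n + 1`.
θ-^[] : ∀ x n → θ (x ^[_]) (suc n) ≡ x * x ^[ n ]
θ-^[] x n = begin
  ι (suc n) * x ^[ suc n ]           ≡⟨ cong (ι (suc n) *_) (^[]-suc x n) ⟩
  ι (suc n) * (u n * (x * x ^[ n ])) ≡⟨ *-assoc (ι (suc n)) (u n) _ ⟨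
  ι (suc n) * u n * (x * x ^[ n ])   ≡⟨ cong (_* (x * x ^[ n ])) (ι*u n) ⟩
  1ℚ * (x * x ^[ n ])                ≡⟨ *-identityˡ _ ⟩
  x * x ^[ n ]                       ∎

0^[suc] : ∀ n → 0ℚ ^[ suc n ] ≡ 0ℚ
0^[suc] n = trans (cong (_* recip (suc n !) {{suc n ℕ.!≢0}}) (*-zeroˡ (0ℚ ^ n)))
  (*-zeroˡ (recip (suc n !) {{suc n ℕ.!≢0}}))

^-^[] : ∀ x n → x ^ n ≡ ι (n !) * x ^[ n ]
^-^[] x zero    = refl
^-^[] x (suc n) = begin
  x * x ^ n                          ≡⟨ cong (x *_) (^-^[] x n) ⟩
  x * (ι (n !) * x ^[ n ])           ≡⟨ solve 3 (λ x i e → x :* (i :* e) := i :* (x :* e))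
                                          refl x (ι (n !)) (x ^[ n ]) ⟩
  ι (n !) * (x * x ^[ n ])           ≡⟨ cong (ι (n !) *_) (θ-^[] x n) ⟨
  ι (n !) * (ι (suc n) * x ^[ suc n ])
    ≡⟨ solve 3 (λ i j e → i :* (j :* e) := (j :* i) :* e) refl (ι (n !)) (ι (suc n)) (x ^[ suc n ]) ⟩
  ι (suc n) * ι (n !) * x ^[ suc n ] ≡⟨ cong (_* x ^[ suc n ]) (ι-* (suc n) (n !)) ⟨
  ι (suc n !) * x ^[ suc n ]         ∎

-- By `θ-^[]` the left index drops by one in every summand, so the lower bound drops too while `n`
-- stays.
conv-θ^[]ˡ : ∀ x g k n → conv (θ (x ^[_])) g (suc k) n ≡ x * conv (x ^[_]) g k n
conv-θ^[]ˡ x g k zero    = trans (cong (_* g 0) (θ-^[] x k)) (*-assoc x (x ^[ k ]) (g 0))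
conv-θ^[]ˡ x g k (suc n) = trans
  (cong₂ _+_ (cong (_* g (suc n)) (θ-^[] x k)) (conv-θ^[]ˡ x g (suc k) n))
  (solve 4 (λ x a b c → (x :* a) :* b :+ x :* c := x :* (a :* b :+ c))
    refl x (x ^[ k ]) (g (suc n)) (conv (x ^[_]) g (suc k) n))

-- Here the right index drops by one; the summand `j = 0` is lost because `θ` multiplies it by 0.
conv-θ^[]ʳ : ∀ f y k n → conv f (θ (y ^[_])) k (suc n) ≡ y * conv f (y ^[_]) k n
conv-θ^[]ʳ f y k zero    = trans
  (cong (λ a → f k * a + f (suc k) * (0ℚ * 1ℚ)) (θ-^[] y 0))
  (solve 3 (λ y a b → a :* (y :* con 1ℚ) :+ b :* con 0ℚ := y :* (a :* con 1ℚ)) refl y (f k) (f (suc k)))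
conv-θ^[]ʳ f y k (suc n) = trans
  (cong₂ (λ a b → f k * a + b) (θ-^[] y (suc n)) (conv-θ^[]ʳ f y (suc k) n))
  (solve 4 (λ y a b c → a :* (y :* b) :+ y :* c := y :* (a :* b :+ c))
    refl y (f k) (y ^[ suc n ]) (conv f (y ^[_]) (suc k) n))

-- Both sides satisfy `(n + 1) c(n + 1) = (x + y) c(n)` with `c(0) = 1`. For the convolution this is
-- the product rule applied to `exp(xt) exp(yt)`.
binomial : ∀ x y n → conv (x ^[_]) (y ^[_]) 0 n ≡ (x + y) ^[ n ]
binomial x y zero    = refl
binomial x y (suc n) = begin
  C                                                ≡⟨ *-identityˡ C ⟨
  -- Inserting `(n + 1) / (n + 1)` makes the product rule applicable.
  1ℚ * C                                           ≡⟨ cong (_* C) (ι*u n) ⟨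
  ι (suc n) * u n * C                              ≡⟨ solve 3 (λ i u c → i :* u :* c := u :* (i :* c))
                                                        refl (ι (suc n)) (u n) C ⟩
  u n * (ι (suc n) * C)                            ≡⟨ cong (u n *_) (θ-conv (x ^[_]) (y ^[_]) 0 (suc n)) ⟩
  -- The vanishing summand `i = 0` stands apart, so the rest starts at 1 as `conv-θ^[]ˡ` requires.
  u n * (0ℚ * 1ℚ * y ^[ suc n ] + conv (θ (x ^[_])) (y ^[_]) 1 n + conv (x ^[_]) (θ (y ^[_])) 0 (suc n))
    ≡⟨ cong₂ (λ a b → u n * (0ℚ * 1ℚ * y ^[ suc n ] + a + b))
         (conv-θ^[]ˡ x (y ^[_]) 0 n) (conv-θ^[]ʳ (x ^[_]) y 0 n) ⟩
  u n * (0ℚ * 1ℚ * y ^[ suc n ] + x * C′ + y * C′)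
    ≡⟨ solve 5 (λ u x y e c → u :* (con 0ℚ :* e :+ x :* c :+ y :* c) := u :* ((x :+ y) :* c))
         refl (u n) x y (y ^[ suc n ]) C′ ⟩
  u n * ((x + y) * C′)                             ≡⟨ cong (λ c → u n * ((x + y) * c)) (binomial x y n) ⟩
  u n * ((x + y) * (x + y) ^[ n ])                 ≡⟨ ^[]-suc (x + y) n ⟨
  (x + y) ^[ suc n ]                               ∎
  where
  C  = conv (x ^[_]) (y ^[_]) 0 (suc n)
  C′ = conv (x ^[_]) (y ^[_]) 0 n

-- Factorial weights of compositions.

1/∏! : List ℕ⁺ → ℚ
1/∏! ξs = recip (product (map _! parts)) {{product≢0 (factorials≢0 parts)}}
  where parts = map value ξs

1/∏!-∷ : ∀ j ξs → 1/∏! (j ∷ ξs) ≡ recip (value j !) {{value j ℕ.!≢0}} * 1/∏! ξs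
1/∏!-∷ j ξs = recip-* (value j !) (product (map _! parts))
  {{value j ℕ.!≢0}} {{product≢0 (factorials≢0 parts)}}
  where parts = map value ξs

-- Isolates the factor `m!`, leaving a weight that is multiplicative over the parts and can
-- therefore be split at the first part.
multinomial-1/∏! : ∀ m ξ → multinomial m ξ ≡ ι (value m !) * 1/∏! (toList ξ)
multinomial-1/∏! m ξ = /-recip (value m !) (product (map _! parts)) {{product≢0 (factorials≢0 parts)}}
  where parts = map value (toList ξ)

-- Powers of harmonic numbers as sums over compositions.

module _ (r : ℕ⁺) where

  ζ/∏! : ℕ → List ℕ⁺ → ℚ
  ζ/∏! n ξs = 1/∏! ξs * ζ≤ n (map (r *⁺_) ξs)

  -- The largest summation index is either at most `n` or equal to `n + 1`. In the second case it
  -- contributes `(n + 1)^-rj`, which together with `1/j!` is a divided power.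
  ζ/∏!-suc : ∀ n j ξs → ζ/∏! (suc n) (j ∷ ξs) ≡
             ζ/∏! n (j ∷ ξs) + (⟨ suc n ⟩ ^- r) ^[ value j ] * ζ/∏! n ξs
  ζ/∏!-suc n j ξs = begin
    1/∏! (j ∷ ξs) * (Z + ⟨ suc n ⟩ ^- (r *⁺ j) * z)
      ≡⟨ *-distribˡ-+ (1/∏! (j ∷ ξs)) Z _ ⟩
    1/∏! (j ∷ ξs) * Z + 1/∏! (j ∷ ξs) * (⟨ suc n ⟩ ^- (r *⁺ j) * z)
      ≡⟨ cong₂ (λ a b → 1/∏! (j ∷ ξs) * Z + a * (b * z)) (1/∏!-∷ j ξs) (^-* ⟨ suc n ⟩ r j) ⟩
    1/∏! (j ∷ ξs) * Z + w * v * (x ^ value j * z)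
      ≡⟨ cong (1/∏! (j ∷ ξs) * Z +_)
           (solve 4 (λ w v y z → w :* v :* (y :* z) := y :* w :* (v :* z)) refl w v (x ^ value j) z) ⟩
    1/∏! (j ∷ ξs) * Z + x ^ value j * w * (v * z) ∎
    where
    Z = ζ≤ n (map (r *⁺_) (j ∷ ξs))
    z = ζ≤ n (map (r *⁺_) ξs)
    v = 1/∏! ξs
    w = recip (value j !) {{value j ℕ.!≢0}}
    x = ⟨ suc n ⟩ ^- r

  ∑ζ/∏!≥ : ℕ → ℕ → ℕ → ℚ
  ∑ζ/∏!≥ n k l = ∑ℚ (compositions≥ k l) (λ ξ → ζ/∏! n (toList ξ))

  -- This is `cₘ(n)`. At `m = 0` it is the term of the empty composition, which arises as the tail
  -- of a one-part composition.
  ∑ζ/∏! : ℕ → ℕ → ℚ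
  ∑ζ/∏! n zero    = ζ/∏! n []
  ∑ζ/∏! n (suc m) = ∑ζ/∏!≥ n 0 m

  -- Compositions with first part `j` gain the `j`-th divided power times the sum over their tails,
  -- and the tails run over all compositions of the remainder. The general lower bound `k` lets the
  -- induction follow the recursion shared by `compositions≥` and `conv`.
  ∑ζ/∏!≥-suc : ∀ n k l → ∑ζ/∏!≥ (suc n) k l ≡
               ∑ζ/∏!≥ n k l + conv ((⟨ suc n ⟩ ^- r) ^[_]) (∑ζ/∏! n) (suc k) l
  ∑ζ/∏!≥-suc n k zero = trans (cong (_+ 0ℚ) (ζ/∏!-suc n ⟨ suc k ⟩ []))
    (solve 2 (λ a b → a :+ b :+ con 0ℚ := a :+ con 0ℚ :+ b) refl
      (ζ/∏! n (⟨ suc k ⟩ ∷ [])) ((⟨ suc n ⟩ ^- r) ^[ suc k ] * ζ/∏! n []))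
  ∑ζ/∏!≥-suc n k (suc l) = begin
    ∑ζ/∏!≥ (suc n) k (suc l)
      ≡⟨ split (suc n) ⟩
    ∑ℚ C (λ ξ → ζ/∏! (suc n) (⟨ suc k ⟩ ∷ toList ξ)) + ∑ζ/∏!≥ (suc n) (suc k) l
      ≡⟨ cong₂ _+_
           (trans (∑ℚ-cong C (λ ξ → ζ/∏!-suc n ⟨ suc k ⟩ (toList ξ)))
             (trans (∑ℚ-+ C _ _) (cong (X +_) (∑ℚ-*ˡ x C _))))
           (∑ζ/∏!≥-suc n (suc k) l) ⟩
    (X + x * ∑ζ/∏!≥ n 0 l) + (∑ζ/∏!≥ n (suc k) l + Y)
      ≡⟨ solve 4 (λ a b c d → (a :+ b) :+ (c :+ d) := (a :+ c) :+ (b :+ d)) refl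
           X (x * ∑ζ/∏!≥ n 0 l) (∑ζ/∏!≥ n (suc k) l) Y ⟩
    (X + ∑ζ/∏!≥ n (suc k) l) + (x * ∑ζ/∏!≥ n 0 l + Y)
      ≡⟨ cong (_+ (x * ∑ζ/∏!≥ n 0 l + Y)) (split n) ⟨
    ∑ζ/∏!≥ n k (suc l) + (x * ∑ζ/∏!≥ n 0 l + Y) ∎
    where
    C = compositions≥ 0 l
    x = (⟨ suc n ⟩ ^- r) ^[ suc k ]
    X = ∑ℚ C (λ ξ → ζ/∏! n (⟨ suc k ⟩ ∷ toList ξ))
    Y = conv ((⟨ suc n ⟩ ^- r) ^[_]) (∑ζ/∏! n) (suc (suc k)) l
    split : ∀ n → ∑ζ/∏!≥ n k (suc l) ≡
            ∑ℚ C (λ ξ → ζ/∏! n (⟨ suc k ⟩ ∷ toList ξ)) + ∑ζ/∏!≥ n (suc k) l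
    split n = trans (∑ℚ-++ (map (⟨ suc k ⟩ ∷⁺_) C) (compositions≥ (suc k) l) (λ ξ → ζ/∏! n (toList ξ)))
      (cong (_+ ∑ζ/∏!≥ n (suc k) l) (∑ℚ-map (⟨ suc k ⟩ ∷⁺_) C (λ ξ → ζ/∏! n (toList ξ))))

  H^[]≡∑ζ/∏! : ∀ n m → H n r ^[ m ] ≡ ∑ζ/∏! n m
  H^[]≡∑ζ/∏! n       zero    = refl
  -- Compositions are nonempty, so each `ζ≤ 0` here is an empty sum.
  H^[]≡∑ζ/∏! zero    (suc m) = trans (0^[suc] m) (sym (trans
    (∑ℚ-cong (compositions≥ 0 m) (λ ξ → *-zeroʳ (1/∏! (toList ξ))))
    (∑ℚ-zero (compositions≥ 0 m))))
  H^[]≡∑ζ/∏! (suc n) (suc m) = begin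
    (H n r + x) ^[ suc m ]                       ≡⟨ cong (_^[ suc m ]) (+-comm (H n r) x) ⟩
    (x + H n r) ^[ suc m ]                       ≡⟨ binomial x (H n r) (suc m) ⟨
    -- The induction is on `n`; its hypothesis is used at every degree up to `suc m`.
    conv (x ^[_]) (H n r ^[_]) 0 (suc m)         ≡⟨ conv-congʳ (x ^[_]) (H^[]≡∑ζ/∏! n) 0 (suc m) ⟩
    -- The summand `i = 0` is the old sum; those with `i ≥ 1` form the increment from `n` to
    -- `n + 1`.
    1ℚ * ∑ζ/∏!≥ n 0 m + conv (x ^[_]) (∑ζ/∏! n) 1 m
      ≡⟨ cong (_+ conv (x ^[_]) (∑ζ/∏! n) 1 m) (*-identityˡ (∑ζ/∏!≥ n 0 m)) ⟩
    ∑ζ/∏!≥ n 0 m + conv (x ^[_]) (∑ζ/∏! n) 1 m   ≡⟨ ∑ζ/∏!≥-suc n 0 m ⟨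
    ∑ζ/∏!≥ (suc n) 0 m                           ∎
    where x = ⟨ suc n ⟩ ^- r

  H^≡∑multinomial*ζ≤ : ∀ n m → H n r ^ value m ≡
    ∑ℚ (compositions m) (λ ξ → multinomial m ξ * ζ≤ n (map (r *⁺_) (toList ξ)))
  H^≡∑multinomial*ζ≤ n m@(⟨ suc m-1 ⟩) = begin
    H n r ^ value m
      ≡⟨ ^-^[] (H n r) (value m) ⟩
    ι (value m !) * H n r ^[ value m ]
      ≡⟨ cong (ι (value m !) *_) (H^[]≡∑ζ/∏! n (value m)) ⟩
    ι (value m !) * ∑ζ/∏!≥ n 0 m-1
      ≡⟨ ∑ℚ-*ˡ (ι (value m !)) (compositions m) (λ ξ → ζ/∏! n (toList ξ)) ⟨
    ∑ℚ (compositions m) (λ ξ → ι (value m !) * ζ/∏! n (toList ξ))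
      ≡⟨ ∑ℚ-cong (compositions m) (λ ξ → sym (trans
           (cong (_* ζ≤ n (map (r *⁺_) (toList ξ))) (multinomial-1/∏! m ξ))
           (*-assoc (ι (value m !)) (1/∏! (toList ξ)) (ζ≤ n (map (r *⁺_) (toList ξ)))))) ⟩
    ∑ℚ (compositions m) (λ ξ → multinomial m ξ * ζ≤ n (map (r *⁺_) (toList ξ))) ∎

  -- The identity between partial sums.

  module _ (m q : ℕ⁺) where

    ζ-term₁ ζ-term₂ : List⁺ ℕ⁺ → ℕ⁺ → ℚ
    ζ-term₁ ξ = ζ-term (q ∷⁺ map⁺ (r *⁺_) ξ)
    ζ-term₂ ξ = ζ-term ((q +⁺ r *⁺ head ξ) ∷ map (r *⁺_) (tail ξ))

    -- With outer index `n₁ = n + 1`, the first term collects `n₂ < n₁` and the second `n₂ = n₁`, so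
    -- together they give `n₂ ≤ n₁`.
    ζ-term₁+ζ-term₂ : ∀ ξ n → ζ-term₁ ξ ⟨ suc n ⟩ + ζ-term₂ ξ ⟨ suc n ⟩ ≡
                      ⟨ suc n ⟩ ^- q * ζ≤ (suc n) (map (r *⁺_) (toList ξ))
    ζ-term₁+ζ-term₂ (j ∷ ξs) n = trans
      (cong (λ a → y * Z + a * z) (^-+ ⟨ suc n ⟩ q (r *⁺ j)))
      (solve 4 (λ y x Z z → y :* Z :+ y :* x :* z := y :* (Z :+ x :* z)) refl
        y (⟨ suc n ⟩ ^- (r *⁺ j)) Z z)
      where
      y = ⟨ suc n ⟩ ^- q
      Z = ζ≤ n (map (r *⁺_) (j ∷ ξs))
      z = ζ≤ n (map (r *⁺_) ξs)

    S-term≡∑ : ∀ n → S-term r m q ⟨ suc n ⟩ ≡ ∑ℚ (compositions m) (λ ξ →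
               multinomial m ξ * (ζ-term₁ ξ ⟨ suc n ⟩ + ζ-term₂ ξ ⟨ suc n ⟩))
    S-term≡∑ n = begin
      H (suc n) r ^ value m * y
        ≡⟨ *-comm _ y ⟩
      y * H (suc n) r ^ value m
        ≡⟨ cong (y *_) (H^≡∑multinomial*ζ≤ (suc n) m) ⟩
      y * ∑ℚ (compositions m) (λ ξ → multinomial m ξ * Z ξ)
        ≡⟨ ∑ℚ-*ˡ y (compositions m) (λ ξ → multinomial m ξ * Z ξ) ⟨
      ∑ℚ (compositions m) (λ ξ → y * (multinomial m ξ * Z ξ))
        ≡⟨ ∑ℚ-cong (compositions m) (λ ξ → trans
             (solve 3 (λ y c z → y :* (c :* z) := c :* (y :* z)) refl y (multinomial m ξ) (Z ξ))
             (cong (multinomial m ξ *_) (sym (ζ-term₁+ζ-term₂ ξ n)))) ⟩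
      ∑ℚ (compositions m) (λ ξ → multinomial m ξ * (ζ-term₁ ξ ⟨ suc n ⟩ + ζ-term₂ ξ ⟨ suc n ⟩)) ∎
      where
      y = ⟨ suc n ⟩ ^- q
      Z : List⁺ ℕ⁺ → ℚ
      Z ξ = ζ≤ (suc n) (map (r *⁺_) (toList ξ))

    ∑≤S-term≡∑ : ∀ N → ∑≤ N (S-term r m q) ≡ ∑ℚ (compositions m) (λ ξ →
                 multinomial m ξ * (∑≤ N (ζ-term₁ ξ) + ∑≤ N (ζ-term₂ ξ)))
    ∑≤S-term≡∑ zero    = sym (trans
      (∑ℚ-cong (compositions m) (λ ξ → *-zeroʳ (multinomial m ξ)))
      (∑ℚ-zero (compositions m)))
    ∑≤S-term≡∑ (suc N) = begin
      ∑≤ N (S-term r m q) + S-term r m q ⟨ suc N ⟩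
        ≡⟨ cong₂ _+_ (∑≤S-term≡∑ N) (S-term≡∑ N) ⟩
      ∑ℚ (compositions m) (λ ξ → multinomial m ξ * (∑≤ N (ζ-term₁ ξ) + ∑≤ N (ζ-term₂ ξ))) +
      ∑ℚ (compositions m) (λ ξ → multinomial m ξ * (ζ-term₁ ξ ⟨ suc N ⟩ + ζ-term₂ ξ ⟨ suc N ⟩))
        ≡⟨ ∑ℚ-+ (compositions m) _ _ ⟨
      ∑ℚ (compositions m) (λ ξ →
        multinomial m ξ * (∑≤ N (ζ-term₁ ξ) + ∑≤ N (ζ-term₂ ξ)) +
        multinomial m ξ * (ζ-term₁ ξ ⟨ suc N ⟩ + ζ-term₂ ξ ⟨ suc N ⟩))
        ≡⟨ ∑ℚ-cong (compositions m) (λ ξ →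
             solve 5 (λ c a b a′ b′ → c :* (a :+ b) :+ c :* (a′ :+ b′) := c :* ((a :+ a′) :+ (b :+ b′)))
               refl (multinomial m ξ) (∑≤ N (ζ-term₁ ξ)) (∑≤ N (ζ-term₂ ξ))
               (ζ-term₁ ξ ⟨ suc N ⟩) (ζ-term₂ ξ ⟨ suc N ⟩)) ⟩
      ∑ℚ (compositions m) (λ ξ → multinomial m ξ * (∑≤ (suc N) (ζ-term₁ ξ) + ∑≤ (suc N) (ζ-term₂ ξ))) ∎

-- From partial sums to real numbers.

≡⇒≈ : ∀ x y → (∀ n → seq x n ≡ seq y n) → x ≈ y
≡⇒≈ x y x≡y ε 0<ε = 0 , λ n _ →
  subst (λ p → ∣ p ∣ ℚ.< ε) (sym (trans (cong (λ p → p ℚ.- seq y n) (x≡y n)) (+-inverseʳ (seq y n)))) 0<ε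

theorem3p4 :
    (m r q : ℕ⁺) (1<q : 1 < value q) →
    S r m q 1<q ≈
      (∑[ ξ ∈ compositions m ]
        multinomial m ξ ·
          ( ζ (q ∷⁺ map⁺ (r *⁺_) ξ) 1<q
          +ᴿ ζ ((q +⁺ r *⁺ head ξ) ∷ map (r *⁺_) (tail ξ)) (1<q⇒1<q+r q (r *⁺ head ξ) 1<q)))
-- The representing sequences agree at every index `N`, since the finite sum over compositions acts
-- on them termwise.
theorem3p4 m r q 1<q = ≡⇒≈ (S r m q 1<q) (∑-over (compositions m) summand) λ N →
  trans (∑≤S-term≡∑ r m q N) (sym (seq-∑-over (compositions m) summand N))
  where
  summand : List⁺ ℕ⁺ → ℝ
  summand ξ = multinomial m ξ ·
    ( ζ (q ∷⁺ map⁺ (r *⁺_) ξ) 1<q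
    +ᴿ ζ ((q +⁺ r *⁺ head ξ) ∷ map (r *⁺_) (tail ξ)) (1<q⇒1<q+r q (r *⁺ head ξ) 1<q))
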